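{- Assume the Univalence Axiom. For each $x,y : M$ there is an equivalence of types $$(x =_M y) \;\simeq\; \mathrm{Id}_M\, x\, y .$$
   Context: The setting is Martin-Löf (homotopy/univalent) type theory; $A:\mathrm{Set}$ means "$A$ is a type" (not necessarily a 0-type), $\mathrm{Id}_A\,x\,y$ is the identity type, and $A\simeq B$ is the type of equivalences as in the Homotopy Type Theory book. The Univalence Axiom is assumed; in particular function extensionality holds for all types. $U:\mathrm{Set}$ is a univalent universe with decoding function $T:U\to\mathrm{Set}$; univalent means that for $a,b:U$ the canonical map $\mathrm{Id}_U\,a\,b\to (T\,a\simeq T\,b)$ is an equivalence. $U$ is assumed closed under $+$, $\Sigma$-, $\Pi$- and identity types. $M := W_{a:U}\,T\,a$ is the W-type with canonical elements $\sup\,a\,f$, where $a:U$ and $f:T\,a\to M$. The relation $=_M\,:M\to M\to\mathrm{Set}$ is defined by recursion: $$(\sup\,a\,f)=_M(\sup\,b\,g)\;:=\;\sum_{\alpha:T a\simeq T b}\ \prod_{x:T a}\ (f\,x)=_M\bigl(g\,(\alpha\,x)\bigr).$$ -}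

{-# OPTIONS --without-K #-}
module Defs where

open import Level using (Level; _⊔_; Setω)
open import Data.Container.Core using (_▷_)
open import Data.Product.Base using (Σ; Σ-syntax; _,_)
open import Data.Sum.Base using (_⊎_)
open import Data.Universe using (Universe)
open import Data.W using (W; sup)
open import Function.Base using (id)
open import Function.Properties.Inverse.HalfAdjointEquivalence using (_≃_)
open import Relation.Binary.PropositionalEquality using (_≡_; refl; cong)

private
  variable
    a b i u t : Level

-- `IsEquiv f` has the same fields as `A ≃ B`, with the forward map fixed to be
-- `f`: it is the HoTT Book's `ishae f`.

record IsEquiv {A : Set a} {B : Set b} (f : A → B) : Set (a ⊔ b) where
  field
    from             : B → A
    left-inverse-of  : ∀ x → from (f x) ≡ x
    right-inverse-of : ∀ y → f (from y) ≡ y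
    left-right       : ∀ x → cong f (left-inverse-of x) ≡ right-inverse-of (f x)

≃-refl : {A : Set a} → A ≃ A
≃-refl = record
  { to               = id
  ; from             = id
  ; left-inverse-of  = λ _ → refl
  ; right-inverse-of = λ _ → refl
  ; left-right       = λ _ → refl
  }

idToEquiv : {I : Set i} (F : I → Set t) (x y : I) → x ≡ y → F x ≃ F y
idToEquiv F x .x refl = ≃-refl

IsUnivalent : {I : Set i} → (I → Set t) → Set (i ⊔ t)
IsUnivalent F = ∀ x y → IsEquiv (idToEquiv F x y)

UnivalenceAxiom : Setω
UnivalenceAxiom = (ℓ : Level) → IsUnivalent {I = Set ℓ} id

-- Closure holds up to equivalence: each type former has a code whose decoding
-- is equivalent to the type formed.  For universes whose codes decode strictly,
-- the equivalences can be taken to be `≃-refl`.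

record IsClosed (𝒰 : Universe u t) : Set (u ⊔ t) where
  open Universe 𝒰
  field
    plus    : U → U → U
    El-plus : ∀ a b → El (plus a b) ≃ (El a ⊎ El b)
    sigma    : (a : U) → (El a → U) → U
    El-sigma : ∀ a b → El (sigma a b) ≃ Σ (El a) (λ x → El (b x))
    pi    : (a : U) → (El a → U) → U
    El-pi : ∀ a b → El (pi a b) ≃ ((x : El a) → El (b x))
    ident    : (a : U) → El a → El a → U
    El-ident : ∀ a x y → El (ident a x y) ≃ (x ≡ y)

module _ (𝒰 : Universe u t) where
  open Universe 𝒰

  M : Set (u ⊔ t)
  M = W (U ▷ El)

module _ {𝒰 : Universe u t} where

  infix 4 _=ᴹ_

  _=ᴹ_ : M 𝒰 → M 𝒰 → Set t
  sup (a , f) =ᴹ sup (b , g) =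
    Σ[ α ∈ Universe.El 𝒰 a ≃ Universe.El 𝒰 b ] (∀ x → f x =ᴹ g (_≃_.to α x))

{-# OPTIONS --without-K #-}
module Submission where

-- Fix x : M.  The family x =ᴹ_ has a canonical element at x, so by the
-- characterisation of identity types through contractible total spaces
-- (total-contractible⇒≃) it is enough to show that the type of all pairs
-- (y , p) with p : x =ᴹ y is contractible.  This is =ᴹ-contraction, by
-- induction on x = sup (a , f).  A point of the total space is given by b, g,
-- an equivalence α : El a ≃ El b and a family h with h i : f i =ᴹ g (α i).
-- Univalence of the universe reduces it to b = a and α = ≃-refl, and then the
-- pairs (g i , h i) form a section of the family of total spaces at the f i,
-- each contractible by the induction hypothesis.  A product of contractible
-- types is contractible (Π-irrelevant), so this section equals the one that
-- consists of the canonical elements.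
--
-- The univalence axiom enters only through Π-irrelevant: a family of
-- contractible types is pointwise equal to the unit type, hence by
-- non-dependent function extensionality it is the constant family at the unit
-- type, whose product has one element.  Non-dependent function extensionality
-- is Voevodsky's argument with the type of paths in the codomain.

open import Defs
open import Data.Product.Base using (Σ; Σ-syntax; _,_; proj₁; proj₂)
open import Data.Unit.Polymorphic.Base using (⊤; tt)
open import Data.Universe using (Universe)
open import Data.W using (sup)
open import Function.Base using (_∘_)
open import Function.Bundles using (mk↔ₛ′)
open import Function.Properties.Inverse.HalfAdjointEquivalence using (_≃_; ↔⇒≃)
open import Level using (Level)
open import Relation.Binary.PropositionalEquality
  using (_≡_; refl; sym; trans; cong; subst)
open import Relation.Binary.PropositionalEquality.Properties using (trans-symˡ)
open import Relation.Nullary.Irrelevant using (Irrelevant)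

private
  variable
    a b i t p : Level

-- Induction on equivalences F x ≃ F y out of a fixed F x, for a univalent
-- family F.
≃-induction : {I : Set i} {F : I → Set t} → IsUnivalent F →
              {x : I} (P : ∀ y → F x ≃ F y → Set p) →
              P x ≃-refl → ∀ y (e : F x ≃ F y) → P y e
≃-induction {F = F} univ {x} P base y e =
  subst (P y) (right-inverse-of e) (onPaths (from e))
  where
  open IsEquiv (univ x y)

  onPaths : ∀ {z} (q : x ≡ z) → P z (idToEquiv F x z q)
  onPaths refl = base

-- The contractions c need not send the base point to refl; the map into the
-- identity type corrects this by composing with the inverse of c at (x , r).
total-contractible⇒≃ : {A : Set a} (B : A → Set b) {x : A} (r : B x) →
                       ((z : Σ A B) → (x , r) ≡ z) →
                       ∀ y → B y ≃ (x ≡ y)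
total-contractible⇒≃ {A = A} B {x} r c y =
  ↔⇒≃ (mk↔ₛ′ decode encode decode-encode encode-decode)
  where
  contraction : (z : Σ A B) → (x , r) ≡ z
  contraction z = trans (sym (c (x , r))) (c z)

  decode : ∀ {z} → B z → x ≡ z
  decode {z} q = cong proj₁ (contraction (z , q))

  encode : ∀ {z} → x ≡ z → B z
  encode q = subst B q r

  decode-encode : ∀ {z} (q : x ≡ z) → decode (encode q) ≡ q
  decode-encode refl = cong (cong proj₁) (trans-symˡ (c (x , r)))

  transport-base : ∀ {w : Σ A B} (q : (x , r) ≡ w) →
                   subst B (cong proj₁ q) r ≡ proj₂ w
  transport-base refl = refl

  encode-decode : ∀ {z} (q : B z) → encode (decode q) ≡ q
  encode-decode q = transport-base (contraction (_ , q))

-- The type of pairs of points of B joined by a path.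
Paths : Set b → Set b
Paths B = Σ[ x ∈ B ] Σ[ y ∈ B ] x ≡ y

Paths≃ : {B : Set b} → Paths B ≃ B
Paths≃ = ↔⇒≃ (mk↔ₛ′ proj₁ (λ x → x , x , refl) (λ _ → refl)
                    (λ { (_ , _ , refl) → refl }))

module _ (ua : UnivalenceAxiom) where

  -- Function extensionality is not needed here: by univalence e may be taken to
  -- be the identity.  The type A may live at any level.
  ∘-injective : {A : Set a} {X Y : Set b} (e : X ≃ Y) (f g : A → X) →
                _≃_.to e ∘ f ≡ _≃_.to e ∘ g → f ≡ g
  ∘-injective {b = b} {A = A} {X} {Y} =
    ≃-induction (ua b)
      (λ Z e → (f g : A → X) → _≃_.to e ∘ f ≡ _≃_.to e ∘ g → f ≡ g)
      (λ _ _ q → q) Y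

  -- A homotopy from f to g is a map into Paths B.  It and the constant homotopy
  -- at f agree after projection to starting points, which is an equivalence;
  -- hence they are equal, and so are their endpoints.
  funext : {A : Set a} {B : Set b} (f g : A → B) →
           (∀ x → f x ≡ g x) → f ≡ g
  funext f g h =
    cong (λ k → proj₁ ∘ proj₂ ∘ k)
      (∘-injective Paths≃ (λ x → f x , f x , refl) (λ x → f x , g x , h x) refl)

  -- Contractibility of each P x is given by a centre s x and a contraction.
  Π-irrelevant : {A : Set a} {P : A → Set p} (s : ∀ x → P x) →
                 (∀ x (y : P x) → s x ≡ y) → Irrelevant (∀ x → P x)
  Π-irrelevant {p = p} {A = A} {P} s c =
    subst (λ Q → Irrelevant (∀ x → Q x)) (sym P≡⊤) (λ _ _ → refl)
    where
    P≃⊤ : ∀ x → P x ≃ ⊤ {p}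
    P≃⊤ x = ↔⇒≃ (mk↔ₛ′ (λ _ → tt) (λ _ → s x) (λ _ → refl) (c x))

    P≡⊤ : P ≡ λ _ → ⊤
    P≡⊤ = funext P (λ _ → ⊤) (λ x → IsEquiv.from (ua p (P x) ⊤) (P≃⊤ x))

=ᴹ-refl : {𝒰 : Universe a t} (x : M 𝒰) → x =ᴹ x
=ᴹ-refl (sup (a , f)) = ≃-refl , λ i → =ᴹ-refl (f i)

module _ (ua : UnivalenceAxiom) (𝒰 : Universe a t)
         (univ : IsUnivalent (Universe.El 𝒰)) where
  open Universe 𝒰

  -- The total space of x =ᴹ_ contracts to the canonical element.
  =ᴹ-contraction : (x : M 𝒰) (z : Σ (M 𝒰) (x =ᴹ_)) → (x , =ᴹ-refl x) ≡ z
  =ᴹ-contraction (sup (a , f)) (sup (b , g) , α , h) =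
    ≃-induction univ
      (λ b α → (g : El b → M 𝒰) (h : ∀ i → f i =ᴹ g (_≃_.to α i)) →
        (sup (a , f) , =ᴹ-refl (sup (a , f))) ≡ (sup (b , g) , α , h))
      (λ g h → cong assemble
        (Π-irrelevant ua canonical (λ i → =ᴹ-contraction (f i))
          canonical (λ i → g i , h i)))
      b α g h
    where
    canonical : ∀ i → Σ (M 𝒰) (f i =ᴹ_)
    canonical i = f i , =ᴹ-refl (f i)

    assemble : (∀ i → Σ (M 𝒰) (f i =ᴹ_)) → Σ (M 𝒰) (sup (a , f) =ᴹ_)
    assemble k = sup (a , proj₁ ∘ k) , ≃-refl , proj₂ ∘ k

theorem3 : UnivalenceAxiom →
    ∀ {u t} (𝒰 : Universe u t) → IsUnivalent (Universe.El 𝒰) → IsClosed 𝒰 →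
    (x y : M 𝒰) → (x =ᴹ y) ≃ (x ≡ y)
theorem3 ua 𝒰 univ _ x =
  total-contractible⇒≃ (x =ᴹ_) (=ᴹ-refl x) (=ᴹ-contraction ua 𝒰 univ x)
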